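{- Let $\Gamma=(N,A,u)$ be a finite normal form game with $N=\{1,\dots,n\}$, $n\ge2$, in which every player has the same strategy set $X$, so $A=X^n$. The following are equivalent: (i) $\Gamma$ is fully symmetric, i.e. $u_i=u_{\pi(i)}\circ\pi$ for every $i\in N$ and every $\pi\in S_N$; (ii) $\Gamma$ is standard symmetric and weakly anonymous; (iii) for each $i\in N$ and $\pi\in S_N$, $u_{\pi(i)}=u_i\circ\pi^{ -1}$; (iv) for each $i\in N$ and each transposition $\tau\in T_N$, $u_i=u_{\tau(i)}\circ\tau$; (v) for each $i\in N$ and each transposition $\tau\in T_N$, $u_i=u_{\tau(i)}\circ\tau^{ -1}$.
   Context: A finite normal form game $\Gamma=(N,A,u)$ consists of players $N$, non-empty finite strategy sets $A_i$, profiles $A=\times_{i\in N}A_i$ and utilities $u_i:A\to\mathbb{R}$. For $\pi\in S_N$ and $s\in A$ write $\pi(s)=(s_{\pi^{ -1}(i)})_{i\in N}$, and for a function $f:A\to\mathbb{R}$, $f\circ\pi$ denotes $s\mapsto f(\pi(s))$. $T_N$ is the set of transpositions in $S_N$. $\Gamma$ is standard symmetric if there is a transitive subgroup $H\le S_N$ such that $u_i=u_{\pi(i)}\circ\pi$ for all $i\in N$ and $\pi\in H$. $\Gamma$ is weakly anonymous if for each $i\in N$ and each permutation $\pi\in S_N$ fixing $i$, $u_i=u_i\circ\pi$. -}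

module Defs where

open import Data.Empty using (⊥)
open import Data.Fin using (Fin)
open import Data.Fin.Permutation using (Permutation′; _⟨$⟩ʳ_; _⟨$⟩ˡ_; _≈_; id; flip; _∘ₚ_; transpose)
open import Data.Nat using (ℕ)
open import Data.Product using (∃; ∃₂; _×_)
open import Data.Rational using (ℚ; _<_)
open import Data.Sum using (_⊎_)
open import Data.Vec using (Vec; lookup; tabulate)
open import Function using (_∘_)
open import Function.Bundles using (_⇔_; _↔_)
open import Relation.Binary.PropositionalEquality using (_≡_; _≢_)

-- Two-sided Dedekind cuts of ℚ.
record ℝ : Set₁ where
  field
    L U         : ℚ → Set
    L-inhabited : ∃ λ q → L q
    U-inhabited : ∃ λ q → U q
    L-rounded   : ∀ p → L p ⇔ (∃ λ q → p < q × L q)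
    U-rounded   : ∀ q → U q ⇔ (∃ λ p → p < q × U p)
    disjoint    : ∀ q → L q → U q → ⊥
    located     : ∀ p q → p < q → L p ⊎ U q

infix 4 _≈ᴿ_ _≐_

-- There are no quotients, so equality of reals is equality of cuts as subsets of ℚ.
_≈ᴿ_ : ℝ → ℝ → Set
x ≈ᴿ y = (∀ q → ℝ.L x q ⇔ ℝ.L y q) × (∀ q → ℝ.U x q ⇔ ℝ.U y q)

_≐_ : {A : Set} → (A → ℝ) → (A → ℝ) → Set
f ≐ g = ∀ s → f s ≈ᴿ g s

-- A profile is a Vec rather than a function Fin n → X: without function
-- extensionality, a utility on functions need not respect pointwise equality.
record Game (n : ℕ) : Set₁ where
  field
    X        : Set
    nonEmpty : X
    finite   : ∃ λ k → X ↔ Fin k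

  Profile : Set
  Profile = Vec X n

  field
    u : Fin n → Profile → ℝ

-- π(s) = (s_{π⁻¹(i)})ᵢ
act : {X : Set} {n : ℕ} → Permutation′ n → Vec X n → Vec X n
act π s = tabulate λ i → lookup s (π ⟨$⟩ˡ i)

record IsSubgroup {n : ℕ} (H : Permutation′ n → Set) : Set where
  field
    resp-≈     : ∀ {π ρ} → π ≈ ρ → H π → H ρ
    id-closed  : H id
    ∘-closed   : ∀ {π ρ} → H π → H ρ → H (π ∘ₚ ρ)
    inv-closed : ∀ {π} → H π → H (flip π)

IsTransitive : {n : ℕ} → (Permutation′ n → Set) → Set
IsTransitive H = ∀ i j → ∃ λ π → H π × π ⟨$⟩ʳ i ≡ j

IsTransposition : {n : ℕ} → Permutation′ n → Set
IsTransposition τ = ∃₂ λ i j → i ≢ j × τ ≈ transpose i j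

module _ {n : ℕ} (Γ : Game n) where
  open Game Γ

  FullySymmetric : Set
  FullySymmetric = ∀ i (π : Permutation′ n) → u i ≐ u (π ⟨$⟩ʳ i) ∘ act π

  StandardSymmetric : Set₁
  StandardSymmetric = ∃ λ (H : Permutation′ n → Set) →
    IsSubgroup H × IsTransitive H × (∀ i π → H π → u i ≐ u (π ⟨$⟩ʳ i) ∘ act π)

  WeaklyAnonymous : Set
  WeaklyAnonymous = ∀ i (π : Permutation′ n) → π ⟨$⟩ʳ i ≡ i → u i ≐ u i ∘ act π

{-# OPTIONS --safe #-}
-- The permutations π with u_i = u_{π(i)} ∘ π for every i form a subgroup of S_N, so it is all of S_N
-- as soon as it contains the transpositions. If instead π is arbitrary and ρ in a transitive group
-- of symmetries satisfies ρ(i) = π(i), then ρ⁻¹π fixes i, and weak anonymity accounts for the difference.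
module Submission where

open import Defs
open import Data.Fin using (Fin)
open import Data.Fin.Permutation using (Permutation′; _⟨$⟩ʳ_; _⟨$⟩ˡ_; flip; _≈_; id; _∘ₚ_; transpose; inverseˡ; inverseʳ)
open import Data.Fin.Permutation.Transposition.List using (TranspositionList; eval; decompose; eval-decompose)
open import Data.Fin.Properties using (_≟_)
open import Data.List.Base using ([]; _∷_)
open import Data.Nat using (ℕ; _≤_)
open import Data.Product using (_×_; _,_)
open import Data.Unit using (⊤; tt)
open import Data.Vec using (Vec; lookup)
open import Data.Vec.Properties using (tabulate-cong; lookup∘tabulate; tabulate∘lookup)
open import Function using (_∘_)
open import Function.Bundles using (_⇔_; mk⇔)
open import Function.Properties.Equivalence using (⇔-isEquivalence)
open import Level using (0ℓ)
open import Relation.Binary.Bundles using (Setoid)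
open import Relation.Binary.PropositionalEquality using (_≡_; refl; sym; trans; cong; cong₂; module ≡-Reasoning)
open import Relation.Binary.Structures using (IsEquivalence)
import Relation.Binary.Reasoning.Setoid as SetoidReasoning
open import Relation.Nullary using (yes; no)
open import Relation.Nullary.Decidable using (dec-true; dec-false)

private
  variable
    n : ℕ
    X : Set

module ⇔ = IsEquivalence (⇔-isEquivalence {0ℓ})

≈ᴿ-isEquivalence : IsEquivalence _≈ᴿ_
≈ᴿ-isEquivalence = record
  { refl  = (λ _ → ⇔.refl) , (λ _ → ⇔.refl)
  ; sym   = λ (l , u) → (λ q → ⇔.sym (l q)) , (λ q → ⇔.sym (u q))
  ; trans = λ (l , u) (l′ , u′) → (λ q → ⇔.trans (l q) (l′ q)) , (λ q → ⇔.trans (u q) (u′ q))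
  }

≈ᴿ-setoid : Setoid _ _
≈ᴿ-setoid = record { isEquivalence = ≈ᴿ-isEquivalence }

-- `_≈_` compares only the forward maps, whereas `act` reads the inverse ones.
≈⇒flip≈ : {π ρ : Permutation′ n} → π ≈ ρ → flip π ≈ flip ρ
≈⇒flip≈ {π = π} {ρ} π≈ρ i = begin
  π ⟨$⟩ˡ i                     ≡⟨ cong (π ⟨$⟩ˡ_) (inverseʳ ρ) ⟨
  π ⟨$⟩ˡ (ρ ⟨$⟩ʳ (ρ ⟨$⟩ˡ i))   ≡⟨ cong (π ⟨$⟩ˡ_) (π≈ρ (ρ ⟨$⟩ˡ i)) ⟨
  π ⟨$⟩ˡ (π ⟨$⟩ʳ (ρ ⟨$⟩ˡ i))   ≡⟨ inverseˡ π ⟩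
  ρ ⟨$⟩ˡ i                     ∎
  where open ≡-Reasoning

transpose-comm : (i j : Fin n) → transpose i j ≈ transpose j i
transpose-comm i j k with k ≟ i | k ≟ j
-- Both tests succeed only if `i` and `j` coincide, and then the two images `j` and `i` agree.
... | yes k≡i | yes k≡j = trans (sym k≡j) k≡i
... | yes k≡i | no  _   rewrite dec-true (k ≟ i) k≡i = refl
... | no  _   | yes k≡j rewrite dec-true (k ≟ j) k≡j = refl
... | no  k≢i | no  k≢j rewrite dec-false (k ≟ i) k≢i | dec-false (k ≟ j) k≢j = refl

-- Covers the degenerate pairs that a `TranspositionList` may contain and that `IsTransposition`
-- excludes.
transpose-refl : (i : Fin n) → id ≈ transpose i i
transpose-refl i k with k ≟ i
... | yes k≡i = k≡i
... | no  k≢i rewrite dec-false (k ≟ i) k≢i = refl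

transpose-matchˡ : (i j : Fin n) → transpose i j ⟨$⟩ʳ i ≡ j
transpose-matchˡ i j rewrite dec-true (i ≟ i) refl = refl

transposition-involutive : (τ : Permutation′ n) → IsTransposition τ → flip τ ≈ τ
transposition-involutive τ (i , j , _ , τ≈ij) k = begin
  -- The inverse map of `transpose i j` is by definition the forward map of `transpose j i`.
  τ ⟨$⟩ˡ k               ≡⟨ ≈⇒flip≈ {π = τ} {transpose i j} τ≈ij k ⟩
  transpose j i ⟨$⟩ʳ k   ≡⟨ transpose-comm j i k ⟩
  transpose i j ⟨$⟩ʳ k   ≡⟨ τ≈ij k ⟨
  τ ⟨$⟩ʳ k               ∎
  where open ≡-Reasoning

-- Every permutation is a product of swaps up to `_≈_`, so closure under products and `resp-≈` carry
-- membership from the swaps to all of the symmetric group.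
subgroup-of-transpositions : {H : Permutation′ n → Set} → IsSubgroup H →
  (∀ τ → IsTransposition τ → H τ) → ∀ π → H π
subgroup-of-transpositions {n} {H} H-subgroup H-transposition π =
  resp-≈ (eval-decompose π) (H-eval (decompose π))
  where
  open IsSubgroup H-subgroup

  H-transpose : ∀ i j → H (transpose i j)
  H-transpose i j with i ≟ j
  ... | yes refl = resp-≈ (transpose-refl i) id-closed
  ... | no  i≢j  = H-transposition (transpose i j) (i , j , i≢j , λ _ → refl)

  H-eval : (xs : TranspositionList n) → H (eval xs)
  H-eval []             = id-closed
  H-eval ((i , j) ∷ xs) = ∘-closed (H-transpose i j) (H-eval xs)

-- Profiles are vectors, so pointwise agreement already yields `_≡_`, along which any utility can be
-- rewritten.
act-cong : {π ρ : Permutation′ n} → π ≈ ρ → (s : Vec X n) → act π s ≡ act ρ s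
act-cong {π = π} {ρ} π≈ρ s = tabulate-cong λ i → cong (lookup s) (≈⇒flip≈ {π = π} {ρ} π≈ρ i)

-- `π ∘ₚ ρ` applies `π` first, so its inverse is the inverse of `ρ` followed by that of `π`; hence
-- `act` is a left action for the usual composition.
act-∘ : (π ρ : Permutation′ n) (s : Vec X n) → act (π ∘ₚ ρ) s ≡ act ρ (act π s)
act-∘ π ρ s = tabulate-cong λ i → sym (lookup∘tabulate _ (ρ ⟨$⟩ˡ i))

act-inverseˡ : (π : Permutation′ n) (s : Vec X n) → act (flip π) (act π s) ≡ s
act-inverseˡ π s = begin
  act (flip π) (act π s)   ≡⟨ act-∘ π (flip π) s ⟨
  act (π ∘ₚ flip π) s      ≡⟨ act-cong {π = π ∘ₚ flip π} {id} (λ _ → inverseˡ π) s ⟩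
  act id s                 ≡⟨ tabulate∘lookup s ⟩
  s                        ∎
  where open ≡-Reasoning

act-inverseʳ : (π : Permutation′ n) (s : Vec X n) → act π (act (flip π) s) ≡ s
act-inverseʳ π = act-inverseˡ (flip π)

module _ (Γ : Game n) where
  open Game Γ using (u)
  open SetoidReasoning ≈ᴿ-setoid

  -- `FullySymmetric` with the two quantifiers exchanged. Having all players inside the predicate is
  -- what makes it closed under products and inverses, where the hypothesis is applied at a player
  -- other than `i`.
  IsSymmetry : Permutation′ n → Set
  IsSymmetry π = ∀ i → u i ≐ u (π ⟨$⟩ʳ i) ∘ act π

  symmetries-subgroup : IsSubgroup IsSymmetry
  symmetries-subgroup = record
    { resp-≈ = λ {π} {ρ} π≈ρ π-sym i s → begin
        u i s                        ≈⟨ π-sym i s ⟩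
        u (π ⟨$⟩ʳ i) (act π s)       ≡⟨ cong₂ u (π≈ρ i) (act-cong {π = π} {ρ} π≈ρ s) ⟩
        u (ρ ⟨$⟩ʳ i) (act ρ s)       ∎
    ; id-closed = λ i s → begin
        u i s                        ≡⟨ cong (u i) (tabulate∘lookup s) ⟨
        u i (act id s)               ∎
    ; ∘-closed = λ {π} {ρ} π-sym ρ-sym i s → begin
        u i s                                           ≈⟨ π-sym i s ⟩
        u (π ⟨$⟩ʳ i) (act π s)                          ≈⟨ ρ-sym (π ⟨$⟩ʳ i) (act π s) ⟩
        u (ρ ⟨$⟩ʳ (π ⟨$⟩ʳ i)) (act ρ (act π s))         ≡⟨ cong (u _) (act-∘ π ρ s) ⟨
        u (π ∘ₚ ρ ⟨$⟩ʳ i) (act (π ∘ₚ ρ) s)              ∎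
    ; inv-closed = λ {π} π-sym i s → begin
        u i s                                                     ≡⟨ cong₂ u (inverseʳ π) (act-inverseʳ π s) ⟨
        -- The hypothesis at the preimages of both the player and the profile, read from right to
        -- left.
        u (π ⟨$⟩ʳ (π ⟨$⟩ˡ i)) (act π (act (flip π) s))            ≈⟨ π-sym (π ⟨$⟩ˡ i) (act (flip π) s) ⟨
        u (flip π ⟨$⟩ʳ i) (act (flip π) s)                        ∎
    }

  fullySymmetric⇒standardSymmetric : FullySymmetric Γ → StandardSymmetric Γ
  fullySymmetric⇒standardSymmetric full =
      -- The whole symmetric group serves as the transitive subgroup; `transpose i j` sends `i` to
      -- `j` even when they coincide.
      (λ _ → ⊤)
    , record { resp-≈ = λ _ _ → tt ; id-closed = tt ; ∘-closed = λ _ _ → tt ; inv-closed = λ _ → tt }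
    , (λ i j → transpose i j , tt , transpose-matchˡ i j)
    , (λ i π _ → full i π)

  fullySymmetric⇒weaklyAnonymous : FullySymmetric Γ → WeaklyAnonymous Γ
  fullySymmetric⇒weaklyAnonymous full i π πi≡i s = begin
    u i s                    ≈⟨ full i π s ⟩
    u (π ⟨$⟩ʳ i) (act π s)   ≡⟨ cong (λ j → u j (act π s)) πi≡i ⟩
    u i (act π s)            ∎

  standardSymmetric∧weaklyAnonymous⇒fullySymmetric :
    StandardSymmetric Γ → WeaklyAnonymous Γ → FullySymmetric Γ
  standardSymmetric∧weaklyAnonymous⇒fullySymmetric (H , _ , H-transitive , H-symmetry) anonymous i π s
    with ρ , ρ∈H , ρi≡πi ← H-transitive i (π ⟨$⟩ʳ i) = begin
    -- First permute the opponents of `i` by `σ`, then move `i` to its image by the symmetry `ρ`;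
    -- together they act as `π`.
    u i s                            ≈⟨ anonymous i σ σi≡i s ⟩
    u i (act σ s)                    ≈⟨ H-symmetry i ρ ρ∈H (act σ s) ⟩
    u (ρ ⟨$⟩ʳ i) (act ρ (act σ s))   ≡⟨ cong₂ u ρi≡πi ρσs≡πs ⟩
    u (π ⟨$⟩ʳ i) (act π s)           ∎
    where
    σ : Permutation′ n
    -- Composition runs from left to right, so this is `π` followed by the inverse of `ρ`.
    σ = π ∘ₚ flip ρ

    σi≡i : σ ⟨$⟩ʳ i ≡ i
    σi≡i = trans (cong (ρ ⟨$⟩ˡ_) (sym ρi≡πi)) (inverseˡ ρ)

    ρσs≡πs : act ρ (act σ s) ≡ act π s
    ρσs≡πs = trans (cong (act ρ) (act-∘ π (flip ρ) s)) (act-inverseʳ ρ (act π s))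

  -- For fixed `i` and `π`, each identity is the other after a change of variable: `act (flip π) s`
  -- for `s` in one direction, `act π s` in the other.
  fullySymmetric⇔inverse :
    FullySymmetric Γ ⇔ (∀ i (π : Permutation′ n) → u (π ⟨$⟩ʳ i) ≐ u i ∘ act (flip π))
  fullySymmetric⇔inverse = mk⇔
    (λ full i π s → begin
      u (π ⟨$⟩ʳ i) s                          ≡⟨ cong (u _) (act-inverseʳ π s) ⟨
      u (π ⟨$⟩ʳ i) (act π (act (flip π) s))   ≈⟨ full i π (act (flip π) s) ⟨
      u i (act (flip π) s)                    ∎)
    (λ inverse i π s → begin
      u i s                                   ≡⟨ cong (u i) (act-inverseˡ π s) ⟨
      u i (act (flip π) (act π s))            ≈⟨ inverse i π (act π s) ⟨
      u (π ⟨$⟩ʳ i) (act π s)                  ∎)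

  fullySymmetric⇔transpositions :
    FullySymmetric Γ ⇔ (∀ i (τ : Permutation′ n) → IsTransposition τ → u i ≐ u (τ ⟨$⟩ʳ i) ∘ act τ)
  fullySymmetric⇔transpositions = mk⇔
    (λ full i τ _ → full i τ)
    -- Moving the player inside turns the hypothesis into `IsSymmetry τ` for each transposition.
    (λ sym-τ i π → subgroup-of-transpositions symmetries-subgroup (λ τ τ∈T j → sym-τ j τ τ∈T) π i)

  -- A transposition is its own inverse, so `act (flip τ)` and `act τ` agree on every profile.
  transpositions⇔inverseTranspositions :
    (∀ i (τ : Permutation′ n) → IsTransposition τ → u i ≐ u (τ ⟨$⟩ʳ i) ∘ act τ)
    ⇔ (∀ i (τ : Permutation′ n) → IsTransposition τ → u i ≐ u (τ ⟨$⟩ʳ i) ∘ act (flip τ))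
  transpositions⇔inverseTranspositions = mk⇔
    (λ sym-τ i τ τ∈T s → begin
      u i s                           ≈⟨ sym-τ i τ τ∈T s ⟩
      u (τ ⟨$⟩ʳ i) (act τ s)          ≡⟨ cong (u _) (act-flip τ τ∈T s) ⟨
      u (τ ⟨$⟩ʳ i) (act (flip τ) s)   ∎)
    (λ sym-τ i τ τ∈T s → begin
      u i s                           ≈⟨ sym-τ i τ τ∈T s ⟩
      u (τ ⟨$⟩ʳ i) (act (flip τ) s)   ≡⟨ cong (u _) (act-flip τ τ∈T s) ⟩
      u (τ ⟨$⟩ʳ i) (act τ s)          ∎)
    where
    act-flip : ∀ τ → IsTransposition τ → (s : Vec (Game.X Γ) n) → act (flip τ) s ≡ act τ s
    act-flip τ τ∈T = act-cong {π = flip τ} {τ} (transposition-involutive τ τ∈T)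

theorem3p15 : (n : ℕ) → 2 ≤ n → (Γ : Game n) → let open Game Γ in
    (FullySymmetric Γ ⇔ (StandardSymmetric Γ × WeaklyAnonymous Γ))
    × (FullySymmetric Γ ⇔ (∀ i (π : Permutation′ n) → u (π ⟨$⟩ʳ i) ≐ u i ∘ act (flip π)))
    × (FullySymmetric Γ ⇔ (∀ i (τ : Permutation′ n) → IsTransposition τ → u i ≐ u (τ ⟨$⟩ʳ i) ∘ act τ))
    × (FullySymmetric Γ ⇔ (∀ i (τ : Permutation′ n) → IsTransposition τ → u i ≐ u (τ ⟨$⟩ʳ i) ∘ act (flip τ)))
theorem3p15 n 2≤n Γ =
    mk⇔ (λ full → fullySymmetric⇒standardSymmetric Γ full , fullySymmetric⇒weaklyAnonymous Γ full)
        (λ (standard , anonymous) → standardSymmetric∧weaklyAnonymous⇒fullySymmetric Γ standard anonymous)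
  , fullySymmetric⇔inverse Γ
  , fullySymmetric⇔transpositions Γ
  , ⇔.trans (fullySymmetric⇔transpositions Γ) (transpositions⇔inverseTranspositions Γ)
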